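{- Let $f\colon\{0,1\}^n\to\{0,1\}$ be a monotone Boolean function. Then the games $\mathsf{KW}^{\mathsf u}_f$ and $\mathsf{KW}^{+}_f$ are equivalent, i.e., each reduces to the other without communication: (1) there are maps $\varphi_A\colon\tilde f^{ -1}(1)\to f^{ -1}(1)$ and $\varphi_B\colon\tilde f^{ -1}(0)\to f^{ -1}(0)$ such that, for all $(\alpha,\beta)\in \tilde f^{ -1}(1)\times\tilde f^{ -1}(0)$, every valid answer of $\mathsf{KW}^{+}_f$ on $(\varphi_A(\alpha),\varphi_B(\beta))$ is a valid answer of $\mathsf{KW}^{\mathsf u}_f$ on $(\alpha,\beta)$; and (2) there are maps $\psi_A\colon f^{ -1}(1)\to\tilde f^{ -1}(1)$ and $\psi_B\colon f^{ -1}(0)\to\tilde f^{ -1}(0)$ such that, for all $(a,b)\in f^{ -1}(1)\times f^{ -1}(0)$, every valid answer of $\mathsf{KW}^{\mathsf u}_f$ on $(\psi_A(a),\psi_B(b))$ is a valid answer of $\mathsf{KW}^{+}_f$ on $(a,b)$. In particular, both games have the same communication cost and the same minimum number of protocol leaves.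
   Context: Let $\mathsf u$ be a third symbol besides $0,1$. A resolution of $\alpha\in\{0,\mathsf u,1\}^n$ is a string $a\in\{0,1\}^n$ with $a_i=\alpha_i$ whenever $\alpha_i\ne\mathsf u$. The hazard-free extension $\tilde f\colon\{0,\mathsf u,1\}^n\to\{0,\mathsf u,1\}$ of $f\colon\{0,1\}^n\to\{0,1\}$ is: $\tilde f(\alpha)=c\in\{0,1\}$ if $f(a)=c$ for all resolutions $a$ of $\alpha$, and $\tilde f(\alpha)=\mathsf u$ otherwise. Hazard-free Karchmer–Wigderson game $\mathsf{KW}^{\mathsf u}_f$: Alice gets $\alpha\in\tilde f^{ -1}(1)$, Bob gets $\beta\in\tilde f^{ -1}(0)$; valid answers are the $i\in[n]$ with $\alpha_i\ne\beta_i$, $\alpha_i\ne\mathsf u$, $\beta_i\ne\mathsf u$. Monotone Karchmer–Wigderson game $\mathsf{KW}^{+}_f$ (for monotone $f$): Alice gets $a\in f^{ -1}(1)$, Bob gets $b\in f^{ -1}(0)$; valid answers are the $i\in[n]$ with $a_i=1$ and $b_i=0$. Communication cost of a game: the minimum over deterministic two-party protocols solving it of the maximum number of bits exchanged. Number of leaves: the minimum number of leaves of a deterministic protocol tree solving the game. -}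

module Defs where

open import Data.Bool.Base using (Bool; true; false; if_then_else_; _≤_)
import Data.Bool.Properties as Bool
open import Data.Fin.Base using (Fin)
import Data.Fin.Properties as Fin
open import Data.Nat.Base as ℕ using (ℕ; zero; suc; _+_; _⊔_)
open import Data.Product.Base using (Σ-syntax; ∃-syntax; _×_; _,_)
open import Data.Vec.Base using (Vec; []; _∷_; lookup)
open import Data.Vec.Relation.Binary.Pointwise.Inductive using (Pointwise)
open import Function.Base using (_∘_)
open import Relation.Binary.Definitions using (DecidableEquality)
open import Relation.Binary.PropositionalEquality.Core using (_≡_; _≢_; refl; cong)
open import Relation.Nullary.Construct.Add.Supremum using (_⁺; [_]; ⊤⁺)
open import Relation.Nullary.Decidable
  using (Dec; yes; no; does; map′; _×-dec_; _→-dec_; ¬?)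
open import Relation.Nullary.Negation.Core using (¬_)
open import Relation.Unary using (Decidable)

------------------------------------------------------------------------
-- Boolean functions and hazard-free extensions

BoolFun : ℕ → Set
BoolFun n = Vec Bool n → Bool

Monotone : ∀ {n} → BoolFun n → Set
Monotone f = ∀ {a b} → Pointwise _≤_ a b → f a ≤ f b

data Ternary : Set where
  bit : Bool → Ternary
  u   : Ternary

IsResolution : ∀ {n} → Vec Ternary n → Vec Bool n → Set
IsResolution α a = ∀ i → lookup α i ≢ u → bit (lookup a i) ≡ lookup α i

ConstantOnResolutions : ∀ {n} → BoolFun n → Vec Ternary n → Bool → Set
ConstantOnResolutions f α c = ∀ a → IsResolution α a → f a ≡ c

_≟_ : DecidableEquality Ternary
bit b ≟ bit c = map′ (cong bit) (λ { refl → refl }) (b Bool.≟ c)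
bit b ≟ u     = no λ ()
u     ≟ bit c = no λ ()
u     ≟ u     = yes refl

isResolution? : ∀ {n} (α : Vec Ternary n) → Decidable (IsResolution α)
isResolution? α a =
  Fin.all? λ i → ¬? (lookup α i ≟ u) →-dec (bit (lookup a i) ≟ lookup α i)

allWords? : ∀ {n} {P : Vec Bool n → Set} → Decidable P → Dec (∀ a → P a)
allWords? {zero}  P? = map′ (λ { p [] → p }) (λ h → h []) (P? [])
allWords? {suc n} P? = map′
  (λ { (p , q) (false ∷ a) → p a ; (p , q) (true ∷ a) → q a })
  (λ h → h ∘ (false ∷_) , h ∘ (true ∷_))
  (allWords? (P? ∘ (false ∷_)) ×-dec allWords? (P? ∘ (true ∷_)))

constantOnResolutions? : ∀ {n} (f : BoolFun n) (α : Vec Ternary n) →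
                         Decidable (ConstantOnResolutions f α)
constantOnResolutions? f α c =
  allWords? λ a → isResolution? α a →-dec (f a Bool.≟ c)

-- Every α has a resolution, so at most one of the two tests succeeds and
-- their order is immaterial.
hazardFree : ∀ {n} → BoolFun n → Vec Ternary n → Ternary
hazardFree f α =
  if does (constantOnResolutions? f α true)  then bit true  else
  if does (constantOnResolutions? f α false) then bit false else
  u

------------------------------------------------------------------------
-- Communication games

record Game (Answer : Set) : Set₁ where
  field
    Alice : Set
    Bob   : Set
    Valid : Alice → Bob → Answer → Set

open Game public

KWᵘ : ∀ {n} → BoolFun n → Game (Fin n)
KWᵘ {n} f = record
  { Alice = Σ[ α ∈ Vec Ternary n ] hazardFree f α ≡ bit true
  ; Bob   = Σ[ β ∈ Vec Ternary n ] hazardFree f β ≡ bit false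
  ; Valid = λ (α , _) (β , _) i →
      lookup α i ≢ lookup β i × lookup α i ≢ u × lookup β i ≢ u
  }

KW⁺ : ∀ {n} → BoolFun n → Game (Fin n)
KW⁺ {n} f = record
  { Alice = Σ[ a ∈ Vec Bool n ] f a ≡ true
  ; Bob   = Σ[ b ∈ Vec Bool n ] f b ≡ false
  ; Valid = λ (a , _) (b , _) i → lookup a i ≡ true × lookup b i ≡ false
  }

ReducesTo : ∀ {A} → Game A → Game A → Set
ReducesTo G H =
  Σ[ φA ∈ (Alice G → Alice H) ] Σ[ φB ∈ (Bob G → Bob H) ]
    (∀ x y i → Valid H (φA x) (φB y) i → Valid G x y i)

------------------------------------------------------------------------
-- Deterministic protocol trees

-- At an inner node the named player sends the given bit of their input;
-- the first subtree is followed on false, the second on true.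
data Protocol (X Y A : Set) : Set where
  leaf  : A → Protocol X Y A
  alice : (X → Bool) → Protocol X Y A → Protocol X Y A → Protocol X Y A
  bob   : (Y → Bool) → Protocol X Y A → Protocol X Y A → Protocol X Y A

module _ {X Y A : Set} where

  run : Protocol X Y A → X → Y → A
  run (leaf i)      x y = i
  run (alice g p q) x y = if g x then run q x y else run p x y
  run (bob   h p q) x y = if h y then run q x y else run p x y

  depth : Protocol X Y A → ℕ
  depth (leaf _)      = 0
  depth (alice _ p q) = suc (depth p ⊔ depth q)
  depth (bob   _ p q) = suc (depth p ⊔ depth q)

  leaves : Protocol X Y A → ℕ
  leaves (leaf _)      = 1
  leaves (alice _ p q) = leaves p + leaves q
  leaves (bob   _ p q) = leaves p + leaves q

ProtocolFor : ∀ {A} → Game A → Set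
ProtocolFor {A} G = Protocol (Alice G) (Bob G) A

Solves : ∀ {A} (G : Game A) → ProtocolFor G → Set
Solves G p = ∀ x y → Valid G x y (run p x y)

-- The minimum of a set of naturals as an extended natural, with
-- min ∅ = ⊤⁺ (infinity).  For KWᵘ and KW⁺ the infinite case occurs only for
-- n = 0, where there is no answer to put on a leaf.
IsMinimum : (ℕ → Set) → ℕ ⁺ → Set
IsMinimum S [ m ] = S m × (∀ k → S k → m ℕ.≤ k)
IsMinimum S ⊤⁺    = ∀ k → ¬ S k

IsCommunicationCost : ∀ {A} → Game A → ℕ ⁺ → Set
IsCommunicationCost G =
  IsMinimum λ c → ∃[ p ] Solves G p × depth p ≡ c

IsLeafNumber : ∀ {A} → Game A → ℕ ⁺ → Set
IsLeafNumber G =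
  IsMinimum λ l → ∃[ p ] Solves G p × leaves p ≡ l

{-# OPTIONS --safe #-}
-- For monotone f, a certificate only needs the ones of a 1-input and the zeros
-- of a 0-input.  Resolving Alice's u's to 0 and Bob's to 1 turns a play of KWᵘ
-- into one of KW⁺, and masking Alice's zeros and Bob's ones by u goes back.
-- Protocols pull back along such reductions without changing their shape.  The
-- minima exist constructively because inputs form a finite set: up to
-- run-equality there are finitely many protocols of bounded depth, and for n > 0
-- exchanging the inputs bit by bit is a protocol solving KW⁺.
module Submission where

open import Defs
open import Axiom.UniquenessOfIdentityProofs using (module Decidable⇒UIP)
open import Data.Bool.Base using (Bool; true; false; not; b≤b)
  renaming (_≤_ to _≤ᵇ_)
import Data.Bool.Properties as Bool
open import Data.Fin.Base using (Fin; zero; suc)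
open import Data.Fin.Subset.Properties using (anySubset?)
open import Data.List.Base as List using (List; []; _∷_; length; allFin)
open import Data.List.Membership.Propositional using (_∈_)
open import Data.List.Membership.Propositional.Properties
  using (∈-cartesianProductWith⁺; ∈-allFin)
open import Data.List.Relation.Unary.All as All using (All; []; _∷_)
open import Data.List.Relation.Unary.Any as Any using (here; there)
open import Data.List.Relation.Unary.Any.Properties using (lookup-index)
open import Data.Nat.Base
  using (ℕ; zero; suc; _+_; _⊔_; _≤_; _<_; z≤n; s≤s)
import Data.Nat.Properties as ℕ
open import Data.Product.Base
  using (Σ; Σ-syntax; ∃-syntax; _×_; _,_; proj₁; proj₂)
open import Data.Sum.Base using (_⊎_; inj₁; inj₂)
open import Data.Vec.Base as Vec using (Vec; []; _∷_; lookup)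
open import Data.Vec.Properties using (lookup-map; lookup∘tabulate)
open import Data.Vec.Relation.Binary.Pointwise.Extensional
  using (ext; extensional⇒inductive)
open import Data.Vec.Relation.Binary.Pointwise.Inductive using (Pointwise)
open import Function.Base using (_∘_)
open import Relation.Binary.Definitions using (_Respects_)
open import Relation.Binary.PropositionalEquality
  using (_≡_; _≢_; _≗_; refl; sym; trans; cong; cong₂; subst; subst₂)
open import Relation.Nullary.Construct.Add.Supremum using ([_]; ⊤⁺)
open import Relation.Nullary.Decidable
  using (Dec; yes; no; map′; _×-dec_; _⊎-dec_)
open import Relation.Nullary.Negation.Core using (¬_; contradiction)
open import Relation.Unary using (Decidable; Irrelevant)

-- Hazard-free extensions and the two reductions

resolve : Bool → Ternary → Bool
resolve c (bit b) = b
resolve c u       = c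

resolve-isResolution : ∀ {n} c (α : Vec Ternary n) →
                       IsResolution α (Vec.map (resolve c) α)
resolve-isResolution c α i αᵢ≢u
  rewrite lookup-map i (resolve c) α with lookup α i
... | bit b = refl
... | u     = contradiction refl αᵢ≢u

-- Resolving `u` away from `c` ensures that an observed `c` was already present in the ternary
-- string, so an answer of `KW⁺` never points at an unknown.
resolve-not : ∀ c t → resolve (not c) t ≡ c → t ≡ bit c
resolve-not c     (bit b) refl = refl
resolve-not false u       ()
resolve-not true  u       ()

-- The first argument is the bit to hide: `false` for Alice, `true` for Bob.
mask : Bool → Bool → Ternary
mask true  true  = u
mask true  false = bit false
mask false true  = bit true
mask false false = u

mask-visible : ∀ c b → mask c b ≢ u → b ≡ not c
mask-visible true  true  v = contradiction refl v
mask-visible true  false v = refl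
mask-visible false true  v = refl
mask-visible false false v = contradiction refl v

module _ {n} (f : BoolFun n) where

  hazardFree⇒constant : ∀ α c → hazardFree f α ≡ bit c →
                        ConstantOnResolutions f α c
  hazardFree⇒constant α c eq with constantOnResolutions? f α true
  hazardFree⇒constant α c refl | yes h = h
  ... | no _ with constantOnResolutions? f α false
  hazardFree⇒constant α c refl | no _ | yes h = h
  hazardFree⇒constant α c ()   | no _ | no _

  constant⇒hazardFree : ∀ α c → ConstantOnResolutions f α c →
                        hazardFree f α ≡ bit c
  constant⇒hazardFree α c h with constantOnResolutions? f α true
  constant⇒hazardFree α true  h | yes _ = refl
  -- The test for `true` comes first, so its success has to be refuted; a single resolution, on
  -- which `f` would take both values, does this.
  constant⇒hazardFree α false h | yes k =
    contradiction (trans (sym (k a r)) (h a r)) λ ()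
    where
    a = Vec.map (resolve false) α
    r = resolve-isResolution false α
  constant⇒hazardFree α true  h | no ¬k = contradiction h ¬k
  constant⇒hazardFree α false h | no ¬k
    with constantOnResolutions? f α false
  ... | yes _ = refl
  ... | no ¬h = contradiction h ¬h

  hazardFree⇒resolve : ∀ c d α → hazardFree f α ≡ bit c →
                       f (Vec.map (resolve d) α) ≡ c
  hazardFree⇒resolve c d α eq =
    hazardFree⇒constant α c eq _ (resolve-isResolution d α)

  KWᵘ-reducesTo-KW⁺ : ReducesTo (KWᵘ f) (KW⁺ f)
  KWᵘ-reducesTo-KW⁺ =
    (λ (α , p) → Vec.map (resolve false) α , hazardFree⇒resolve true  false α p) ,
    (λ (β , q) → Vec.map (resolve true)  β , hazardFree⇒resolve false true  β q) ,
    λ (α , _) (β , _) i (aᵢ , bᵢ) →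
      let αᵢ = resolve-not true  _ (trans (sym (lookup-map i (resolve false) α)) aᵢ)
          βᵢ = resolve-not false _ (trans (sym (lookup-map i (resolve true)  β)) bᵢ)
      in (λ eq → contradiction (trans (sym αᵢ) (trans eq βᵢ)) λ ()) ,
         (λ eq → contradiction (trans (sym αᵢ) eq) λ ()) ,
         (λ eq → contradiction (trans (sym βᵢ) eq) λ ())

  module _ (mono : Monotone f) where

    -- Only zeros were hidden, so a resolution keeps every one of `a` and can differ from `a` only
    -- by raising zeros.
    mask-resolution-≥ : ∀ {a a′ : Vec Bool n} →
                        IsResolution (Vec.map (mask false) a) a′ →
                        Pointwise _≤ᵇ_ a a′
    mask-resolution-≥ {a} {a′} r = extensional⇒inductive (ext bound)
      where
      bound : ∀ i → lookup a i ≤ᵇ lookup a′ i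
      bound i with lookup a i | r i | lookup-map i (mask false) a
      ... | false | _ | _  = Bool.≤-minimum _
      ... | true  | h | eq rewrite eq with lookup a′ i | h (λ ())
      ...   | true | _ = b≤b

    mask-resolution-≤ : ∀ {b b′ : Vec Bool n} →
                        IsResolution (Vec.map (mask true) b) b′ →
                        Pointwise _≤ᵇ_ b′ b
    mask-resolution-≤ {b} {b′} r = extensional⇒inductive (ext bound)
      where
      bound : ∀ i → lookup b′ i ≤ᵇ lookup b i
      bound i with lookup b i | r i | lookup-map i (mask true) b
      ... | true  | _ | _  = Bool.≤-maximum _
      ... | false | h | eq rewrite eq with lookup b′ i | h (λ ())
      ...   | false | _ = b≤b

    -- Monotonicity enters here: every resolution of the masked string lies above `a`, where `f` is
    -- still `true`.
    hazardFree-mask-true : ∀ a → f a ≡ true →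
                           hazardFree f (Vec.map (mask false) a) ≡ bit true
    hazardFree-mask-true a fa =
      constant⇒hazardFree (Vec.map (mask false) a) true λ a′ r →
        Bool.≤-antisym (Bool.≤-maximum _)
          (subst (_≤ᵇ f a′) fa (mono (mask-resolution-≥ r)))

    hazardFree-mask-false : ∀ b → f b ≡ false →
                            hazardFree f (Vec.map (mask true) b) ≡ bit false
    hazardFree-mask-false b fb =
      constant⇒hazardFree (Vec.map (mask true) b) false λ b′ r →
        Bool.≤-antisym (subst (f b′ ≤ᵇ_) fb (mono (mask-resolution-≤ r)))
          (Bool.≤-minimum _)

    KW⁺-reducesTo-KWᵘ : ReducesTo (KW⁺ f) (KWᵘ f)
    KW⁺-reducesTo-KWᵘ =
      (λ (a , p) → Vec.map (mask false) a , hazardFree-mask-true a p) ,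
      (λ (b , q) → Vec.map (mask true) b , hazardFree-mask-false b q) ,
      λ (a , _) (b , _) i (_ , αᵢ≢u , βᵢ≢u) →
        mask-visible false _ (αᵢ≢u ∘ trans (lookup-map i (mask false) a)) ,
        mask-visible true  _ (βᵢ≢u ∘ trans (lookup-map i (mask true) b))

-- Protocols under reductions

module _ {X Y X′ Y′ A : Set} (φ : X → X′) (ψ : Y → Y′) where

  pullback : Protocol X′ Y′ A → Protocol X Y A
  pullback (leaf i)      = leaf i
  pullback (alice g p q) = alice (g ∘ φ) (pullback p) (pullback q)
  pullback (bob   h p q) = bob   (h ∘ ψ) (pullback p) (pullback q)

  run-pullback : ∀ p x y → run (pullback p) x y ≡ run p (φ x) (ψ y)
  run-pullback (leaf i)      x y = refl
  run-pullback (alice g p q) x y with g (φ x)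
  ... | true  = run-pullback q x y
  ... | false = run-pullback p x y
  run-pullback (bob h p q)   x y with h (ψ y)
  ... | true  = run-pullback q x y
  ... | false = run-pullback p x y

  depth-pullback : ∀ p → depth (pullback p) ≡ depth p
  depth-pullback (leaf i)      = refl
  depth-pullback (alice g p q) =
    cong suc (cong₂ _⊔_ (depth-pullback p) (depth-pullback q))
  depth-pullback (bob h p q)   =
    cong suc (cong₂ _⊔_ (depth-pullback p) (depth-pullback q))

  leaves-pullback : ∀ p → leaves (pullback p) ≡ leaves p
  leaves-pullback (leaf i)      = refl
  leaves-pullback (alice g p q) = cong₂ _+_ (leaves-pullback p) (leaves-pullback q)
  leaves-pullback (bob h p q)   = cong₂ _+_ (leaves-pullback p) (leaves-pullback q)

-- Both measures are bundled so that one transport argument serves communication cost and leaf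
-- number alike.
record SameSize {X Y X′ Y′ A : Set}
                (p : Protocol X Y A) (q : Protocol X′ Y′ A) : Set where
  constructor _,_
  field
    depth≡  : depth p ≡ depth q
    leaves≡ : leaves p ≡ leaves q

open SameSize

reduce : ∀ {A} {G H : Game A} → ReducesTo G H →
         ∀ p → Solves H p → ∃[ q ] Solves G q × SameSize q p
reduce {G = G} (φ , ψ , sound) p solves =
  pullback φ ψ p ,
  (λ x y → subst (Valid G x y) (sym (run-pullback φ ψ p x y))
             (sound x y _ (solves (φ x) (ψ y)))) ,
  (depth-pullback φ ψ p , leaves-pullback φ ψ p)

-- This confines the search for a protocol with a given leaf count to bounded depth. Strictness
-- carries the induction: `d < k` and `e < l` give `d + e + 2 ≤ k + l`, which leaves room for the
-- new node.
depth<leaves : ∀ {X Y A : Set} (p : Protocol X Y A) → depth p < leaves p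
depth<leaves = go
  where
  node : ∀ {d e k l} → d < k → e < l → suc (d ⊔ e) < k + l
  node {d} {e} d<k e<l = ℕ.≤-trans
    (s≤s (subst (suc (d ⊔ e) ≤_) (sym (ℕ.+-suc d e)) (s≤s (ℕ.m⊔n≤m+n d e))))
    (ℕ.+-mono-≤ d<k e<l)
  go : ∀ p → depth p < leaves p
  go (leaf _)      = s≤s z≤n
  go (alice _ p q) = node (go p) (go q)
  go (bob   _ p q) = node (go p) (go q)

-- Finite types

Finite : Set → Set
Finite X = Σ[ xs ∈ List X ] (∀ x → x ∈ xs)

words : ∀ n → Finite (Vec Bool n)
words zero    = [] ∷ [] , λ { [] → here refl }
words (suc n) = List.cartesianProductWith _∷_ bits as , λ
  { (false ∷ a) → extend (here refl) (complete a)
  ; (true  ∷ a) → extend (there (here refl)) (complete a) }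
  where
  bits     = false ∷ true ∷ []
  as       = proj₁ (words n)
  complete = proj₂ (words n)
  extend   = ∈-cartesianProductWith⁺ _∷_ {xs = bits} {ys = as}

module _ {X : Set} {P : X → Set} (P? : Decidable P) (irr : Irrelevant P) where

  subtype : List X → List (Σ X P)
  subtype []       = []
  subtype (x ∷ xs) with P? x
  ... | yes p = (x , p) ∷ subtype xs
  ... | no _  = subtype xs

  -- The list stores the proof returned by `P?`; irrelevance identifies it with the given `p`.
  ∈-subtype : ∀ {x xs} (p : P x) → x ∈ xs → (x , p) ∈ subtype xs
  ∈-subtype {xs = x ∷ _} p (here refl) with P? x
  ... | yes p′ = here (cong (x ,_) (irr p p′))
  ... | no ¬p  = contradiction p ¬p
  ∈-subtype {xs = x ∷ _} p (there x∈) with P? x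
  ... | yes _ = there (∈-subtype p x∈)
  ... | no _  = ∈-subtype p x∈

  subtype-finite : Finite X → Finite (Σ X P)
  subtype-finite (xs , complete) =
    subtype xs , λ (x , p) → ∈-subtype p (complete x)

module _ {X : Set} (finX : Finite X) where

  private
    xs       = proj₁ finX
    complete = proj₂ finX

  all? : {P : X → Set} → Decidable P → Dec (∀ x → P x)
  all? P? = map′ (λ h x → All.lookup h (complete x)) (λ h → All.tabulate λ {x} _ → h x)
                 (All.all? P? xs)

  private
    fromTable : Vec Bool (length xs) → X → Bool
    fromTable v x = lookup v (Any.index (complete x))

    fromTable-tabulate : ∀ g → fromTable (Vec.tabulate (g ∘ List.lookup xs)) ≗ g
    fromTable-tabulate g x =
      trans (lookup∘tabulate _ (Any.index (complete x)))
            (cong g (sym (lookup-index (complete x))))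

  -- A test is coded by its table along the enumeration, and a table is a subset of the positions.
  -- Decoding recovers a test only pointwise, hence the demand that `P` respect `_≗_`.
  anyTest? : {P : (X → Bool) → Set} → P Respects _≗_ → Decidable P → Dec (∃[ g ] P g)
  anyTest? resp P? =
    map′ (λ (v , p) → fromTable v , p)
         (λ (g , p) → Vec.tabulate (g ∘ List.lookup xs) ,
                      resp (sym ∘ fromTable-tabulate g) p)
         (anySubset? (P? ∘ fromTable))

-- Deciding the existence of a protocol

module _ {X Y A : Set} where

  infix 4 _≈_

  -- Tests are enumerated only up to pointwise equality, so protocols are compared by behaviour and
  -- size instead of `_≡_`.
  record _≈_ (p q : Protocol X Y A) : Set where
    constructor _,_
    field
      run≡      : ∀ x y → run p x y ≡ run q x y
      same-size : SameSize p q

  ≈-refl : ∀ {p} → p ≈ p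
  ≈-refl = (λ _ _ → refl) , (refl , refl)

  alice-cong : ∀ {g g′ p p′ q q′} → g ≗ g′ → p ≈ p′ → q ≈ q′ →
               alice g p q ≈ alice g′ p′ q′
  alice-cong {g} {g′} {p} {p′} {q} {q′} g≗g′ (rp , (dp , lp)) (rq , (dq , lq)) =
    runs , (cong suc (cong₂ _⊔_ dp dq) , cong₂ _+_ lp lq)
    where
    runs : ∀ x y → run (alice g p q) x y ≡ run (alice g′ p′ q′) x y
    runs x y rewrite g≗g′ x with g′ x
    ... | true  = rq x y
    ... | false = rp x y

  bob-cong : ∀ {h h′ p p′ q q′} → h ≗ h′ → p ≈ p′ → q ≈ q′ →
             bob h p q ≈ bob h′ p′ q′
  bob-cong {h} {h′} {p} {p′} {q} {q′} h≗h′ (rp , (dp , lp)) (rq , (dq , lq)) =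
    runs , (cong suc (cong₂ _⊔_ dp dq) , cong₂ _+_ lp lq)
    where
    runs : ∀ x y → run (bob h p q) x y ≡ run (bob h′ p′ q′) x y
    runs x y rewrite h≗h′ y with h′ y
    ... | true  = rq x y
    ... | false = rp x y

  module _ (finX : Finite X) (finY : Finite Y) (finA : Finite A) where

    anyLeaf? : {P : Protocol X Y A → Set} → Decidable P → Dec (∃[ i ] P (leaf i))
    anyLeaf? P? = map′ Any.satisfied
      (λ (i , p) → Any.map (λ { refl → p }) (proj₂ finA i))
      (Any.any? (P? ∘ leaf) (proj₁ finA))

    -- Induction on the depth bound: the root is a leaf or one of finitely many tests, and the
    -- subtrees have a smaller bound. `P` is arbitrary because the recursion changes it.
    anyProtocol? : ∀ d {P : Protocol X Y A → Set} → P Respects _≈_ →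
                   Decidable P → Dec (∃[ p ] depth p ≤ d × P p)
    anyProtocol? zero resp P? =
      map′ (λ (i , h) → leaf i , z≤n , h) (λ { (leaf i , _ , h) → i , h })
           (anyLeaf? P?)
    anyProtocol? (suc d) {P} resp P? = map′ to from
      (anyLeaf? P?
       ⊎-dec anyTest? finX
         (λ { g≗ (p , p≤ , q , q≤ , h) →
              p , p≤ , q , q≤ , resp (alice-cong g≗ ≈-refl ≈-refl) h })
         (λ g → anyPair? (λ p≈ q≈ → resp (alice-cong (λ _ → refl) p≈ q≈))
                         (λ p q → P? (alice g p q)))
       ⊎-dec anyTest? finY
         (λ { g≗ (p , p≤ , q , q≤ , h) →
              p , p≤ , q , q≤ , resp (bob-cong g≗ ≈-refl ≈-refl) h })
         (λ g → anyPair? (λ p≈ q≈ → resp (bob-cong (λ _ → refl) p≈ q≈))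
                         (λ p q → P? (bob g p q))))
      where
      Pair : (Protocol X Y A → Protocol X Y A → Set) → Set
      Pair Q = ∃[ p ] depth p ≤ d × (∃[ q ] depth q ≤ d × Q p q)

      anyPair? : ∀ {Q} → (∀ {p p′ q q′} → p ≈ p′ → q ≈ q′ → Q p q → Q p′ q′) →
                 (∀ p q → Dec (Q p q)) → Dec (Pair Q)
      -- The property of `p` sought by the outer search is itself the success of an inner search for
      -- `q`.
      anyPair? respQ Q? = anyProtocol? d
        (λ p≈ (q , q≤ , h) → q , q≤ , respQ p≈ ≈-refl h)
        (λ p → anyProtocol? d (respQ ≈-refl) (Q? p))

      to : (∃[ i ] P (leaf i))
           ⊎ (∃[ g ] Pair (λ p q → P (alice g p q)))
           ⊎ (∃[ h ] Pair (λ p q → P (bob h p q))) →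
           ∃[ p ] depth p ≤ suc d × P p
      to (inj₁ (i , h)) = leaf i , z≤n , h
      to (inj₂ (inj₁ (g , p , p≤ , q , q≤ , h))) =
        alice g p q , s≤s (ℕ.⊔-lub p≤ q≤) , h
      to (inj₂ (inj₂ (g , p , p≤ , q , q≤ , h))) =
        bob g p q , s≤s (ℕ.⊔-lub p≤ q≤) , h

      from : (∃[ p ] depth p ≤ suc d × P p) →
             (∃[ i ] P (leaf i))
             ⊎ (∃[ g ] Pair (λ p q → P (alice g p q)))
             ⊎ (∃[ h ] Pair (λ p q → P (bob h p q)))
      from (leaf i , _ , h) = inj₁ (i , h)
      from (alice g p q , s≤s pq≤ , h) = inj₂ (inj₁
        (g , p , ℕ.m⊔n≤o⇒m≤o _ _ pq≤ , q , ℕ.m⊔n≤o⇒n≤o (depth p) _ pq≤ , h))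
      from (bob g p q , s≤s pq≤ , h) = inj₂ (inj₂
        (g , p , ℕ.m⊔n≤o⇒m≤o _ _ pq≤ , q , ℕ.m⊔n≤o⇒n≤o (depth p) _ pq≤ , h))

-- Minima

least : ∀ {S : ℕ → Set} → Decidable S → ∀ k → S k → ∃[ m ] IsMinimum S [ m ]
least S? zero    s = zero , s , λ _ _ → z≤n
least S? (suc k) s with S? zero
... | yes s₀ = zero , s₀ , λ _ _ → z≤n
... | no ¬s₀ with m , sₘ , minimal ← least (S? ∘ suc) k s =
  suc m , sₘ , λ { zero s₀ → contradiction s₀ ¬s₀ ; (suc j) sⱼ → s≤s (minimal j sⱼ) }

isMinimum-resp : ∀ {S T : ℕ → Set} → (∀ k → S k → T k) → (∀ k → T k → S k) →
                 ∀ m → IsMinimum S m → IsMinimum T m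
isMinimum-resp S⊆T T⊆S [ m ] (s , minimal) = S⊆T m s , λ k → minimal k ∘ T⊆S k
isMinimum-resp S⊆T T⊆S ⊤⁺    none          = λ k → none k ∘ T⊆S k

-- What depth and leaf count share. `depth≤size` makes it decidable whether a size is achieved, and
-- `size-cong` makes sizes survive reductions.
record SizeMeasure (A : Set) : Set₁ where
  field
    size       : ∀ {X Y} → Protocol X Y A → ℕ
    size-cong  : ∀ {X Y X′ Y′} {p : Protocol X Y A} {q : Protocol X′ Y′ A} →
                 SameSize p q → size p ≡ size q
    depth≤size : ∀ {X Y} (p : Protocol X Y A) → depth p ≤ size p

depthMeasure leavesMeasure : ∀ {A} → SizeMeasure A
depthMeasure = record
  { size = depth ; size-cong = depth≡ ; depth≤size = λ _ → ℕ.≤-refl }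
leavesMeasure = record
  { size = leaves ; size-cong = leaves≡ ; depth≤size = ℕ.<⇒≤ ∘ depth<leaves }

module _ {A : Set} (M : SizeMeasure A) where
  open SizeMeasure M

  Achieves : Game A → ℕ → Set
  Achieves G k = ∃[ p ] Solves G p × size p ≡ k

  achieves-reduce : ∀ (G H : Game A) → ReducesTo G H →
                    ∀ k → Achieves H k → Achieves G k
  achieves-reduce G H r k (p , solves , eq)
    with q , solves′ , same ← reduce {G = G} {H} r p solves =
    q , solves′ , trans (size-cong same) eq

  module _ (G : Game A) (finX : Finite (Alice G)) (finY : Finite (Bob G))
           (finA : Finite A) (valid? : ∀ x y i → Dec (Valid G x y i)) where

    achieves? : Decidable (Achieves G)
    achieves? k = map′ (λ (p , _ , h) → p , h)
      -- A protocol of size `k` has depth at most `k`, so the bounded search misses none.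
      (λ { (p , s , refl) → p , depth≤size p , s , refl })
      (anyProtocol? finX finY finA k
        (λ { (runs , same) (s , eq) →
             (λ x y → subst (Valid G x y) (runs x y) (s x y)) ,
             trans (sym (size-cong same)) eq })
        (λ p → all? finX (λ x → all? finY λ y → valid? x y (run p x y))
               ×-dec (size p ℕ.≟ k)))

    -- Solvability is decided beforehand: a solving protocol bounds the search for the least size,
    -- and its absence makes the minimum infinite.
    minimum : Dec (∃[ p ] Solves G p) → ∃[ m ] IsMinimum (Achieves G) m
    minimum (yes (p , s)) with m , h ← least achieves? (size p) (p , s , refl) =
      [ m ] , h
    minimum (no ¬p) = ⊤⁺ , λ k (p , s , _) → ¬p (p , s)

-- Solving the monotone game by exchange, and the common minima

module _ {n} (f : BoolFun n) (mono : Monotone f) where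

  -- Bob replies only to a one from Alice, and his first reply of zero ends the play with a valid
  -- answer. The leaf `default` is reached only when no listed coordinate separates the inputs.
  exchange : Fin n → List (Fin n) → ProtocolFor (KW⁺ f)
  exchange default []       = leaf default
  exchange default (i ∷ is) =
    alice (λ (a , _) → lookup a i)
      (exchange default is)
      (bob (λ (b , _) → lookup b i) (leaf i) (exchange default is))

  -- The second alternative is the invariant of an unsuccessful play: on the listed coordinates,
  -- Alice's string lies below Bob's.
  exchange-correct : ∀ j is x y →
    Valid (KW⁺ f) x y (run (exchange j is) x y)
    ⊎ All (λ i → lookup (proj₁ x) i ≤ᵇ lookup (proj₁ y) i) is
  exchange-correct j []       x y = inj₂ []
  exchange-correct j (i ∷ is) x y
    with lookup (proj₁ x) i in aᵢ | lookup (proj₁ y) i in bᵢ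
       | exchange-correct j is x y
  ... | false | _     | inj₁ v  = inj₁ v
  ... | false | _     | inj₂ ≤s =
    inj₂ (subst (_≤ᵇ _) (sym aᵢ) (Bool.≤-minimum _) ∷ ≤s)
  ... | true  | true  | inj₁ v  = inj₁ v
  ... | true  | true  | inj₂ ≤s =
    inj₂ (Bool.≤-reflexive (trans aᵢ (sym bᵢ)) ∷ ≤s)
  ... | true  | false | _       = inj₁ (aᵢ , bᵢ)

  exchange-solves : ∀ j → Solves (KW⁺ f) (exchange j (allFin n))
  exchange-solves j x@(a , fa) y@(b , fb) with exchange-correct j (allFin n) x y
  ... | inj₁ v  = v
  -- With all coordinates listed this means `a ≤ b`, and monotonicity would give `true ≤ false`.
  ... | inj₂ ≤s = contradiction (subst₂ _≤ᵇ_ fa fb (mono a≤b)) λ ()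
    where a≤b = extensional⇒inductive (ext λ i → All.lookup ≤s (∈-allFin i))

  KW⁺-minimum : (M : SizeMeasure (Fin n)) → ∃[ m ] IsMinimum (Achieves M (KW⁺ f)) m
  KW⁺-minimum M = minimum M (KW⁺ f) (fibre true) (fibre false)
    (allFin n , ∈-allFin)
    (λ (a , _) (b , _) i → (lookup a i Bool.≟ true) ×-dec (lookup b i Bool.≟ false))
    (solvable? n refl)
    where
    open Decidable⇒UIP Bool._≟_ using (≡-irrelevant)

    fibre : ∀ c → Finite (Σ[ a ∈ Vec Bool n ] f a ≡ c)
    fibre c = subtype-finite (λ a → f a Bool.≟ c) ≡-irrelevant (words n)

    -- The type of `f` fixes `n`, so the case split is on a fresh `m` equal to it. For zero
    -- coordinates no leaf can be labelled, hence no tree exists.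
    solvable? : ∀ m → n ≡ m → Dec (∃[ p ] Solves (KW⁺ f) p)
    solvable? (suc m) refl = yes (exchange zero (allFin n) , exchange-solves zero)
    solvable? zero    refl = no λ (p , _) → noProtocol p
      where
      noProtocol : ∀ {X Y} → ¬ Protocol X Y (Fin 0)
      noProtocol (leaf ())
      noProtocol (alice _ p _) = noProtocol p
      noProtocol (bob   _ p _) = noProtocol p

  -- The two reductions show that both games achieve the same set of sizes, so the minimum found for
  -- `KW⁺` also serves `KWᵘ`.
  common-minimum : (M : SizeMeasure (Fin n)) →
    ∃[ m ] IsMinimum (Achieves M (KWᵘ f)) m × IsMinimum (Achieves M (KW⁺ f)) m
  common-minimum M with m , h ← KW⁺-minimum M =
    m , isMinimum-resp (achieves-reduce M (KWᵘ f) (KW⁺ f) (KWᵘ-reducesTo-KW⁺ f))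
                       (achieves-reduce M (KW⁺ f) (KWᵘ f) (KW⁺-reducesTo-KWᵘ f mono))
                       m h ,
    h

theorem4p11 : ∀ (n : ℕ) (f : BoolFun n) → Monotone f →
    ReducesTo (KWᵘ f) (KW⁺ f)
    × ReducesTo (KW⁺ f) (KWᵘ f)
    × (∃[ c ] IsCommunicationCost (KWᵘ f) c × IsCommunicationCost (KW⁺ f) c)
    × (∃[ l ] IsLeafNumber (KWᵘ f) l × IsLeafNumber (KW⁺ f) l)
theorem4p11 n f mono =
  KWᵘ-reducesTo-KW⁺ f , KW⁺-reducesTo-KWᵘ f mono ,
  -- For these two measures `Achieves` unfolds to the sets in `IsCommunicationCost` and
  -- `IsLeafNumber`.
  common-minimum f mono depthMeasure , common-minimum f mono leavesMeasure
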